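{- Let $d\in\mathbb{N}$, let $(\Gamma,\leq_\Gamma)$ be a well-quasi-order, and let $\Sigma_{d,\Gamma}$ be the generalized level-$d$ priority alphabet over $\Gamma$. Then $(\Sigma_{d,\Gamma}^*,\sqsubseteq_{\mathrm{p},\Gamma})$, the set of finite words over $\Sigma_{d,\Gamma}$ with the generalized priority embedding, is a well-quasi-order.
   Context: For $d\in\mathbb{N}$ and a well-quasi-order $(\Gamma,\leq_\Gamma)$, $\Sigma_{d,\Gamma}=\{(a,w)\mid a\in\mathbb{N},\ 0\le a\le d,\ w\in\Gamma\}$. For $0\le a\le d$, $\Sigma_{a,\Gamma}^*\subseteq\Sigma_{d,\Gamma}^*$ is the set of words all of whose letters have first component at most $a$. The generalized priority embedding on $\Sigma_{d,\Gamma}^*$: $x\sqsubseteq_{\mathrm{p},\Gamma}y$ iff, writing $x=(a_1,v_1)\cdots(a_\ell,v_\ell)$, the word $y$ can be factored as $y=y_1\,(a_1,w_1)\,y_2\,(a_2,w_2)\cdots y_\ell\,(a_\ell,w_\ell)$ with $y_i\in\Sigma_{a_i,\Gamma}^*$ and $v_i\leq_\Gamma w_i$ for all $i=1,\ldots,\ell$. (In particular $\epsilon\sqsubseteq_{\mathrm{p},\Gamma}y$ iff $y=\epsilon$.) A quasi-order $(A,\leq_A)$ is a well-quasi-order if every infinite sequence $x_0,x_1,\ldots$ over $A$ has indices $i<j$ with $x_i\leq_A x_j$. -}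

module Defs where

open import Data.Fin.Base as Fin using (Fin)
open import Data.List.Base using (List; []; _∷_; _++_)
open import Data.List.Relation.Unary.All using (All)
open import Data.Nat.Base using (ℕ; suc; _<_)
open import Data.Product.Base using (_×_; _,_; proj₁; ∃₂)
open import Level using (Level; _⊔_)
open import Relation.Binary.Core using (Rel)
open import Relation.Binary.PropositionalEquality.Core using (_≡_)
open import Relation.Binary.Structures using (IsPreorder)

private
  variable
    a ℓ : Level

record IsWellQuasiOrder {A : Set a} (_≤_ : Rel A ℓ) : Set (a ⊔ ℓ) where
  field
    isQuasiOrder : IsPreorder _≡_ _≤_
    good         : (x : ℕ → A) → ∃₂ λ i j → i < j × x i ≤ x j

Letter : ℕ → Set a → Set a
Letter d Γ = Fin (suc d) × Γ

Word : ℕ → Set a → Set a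
Word d Γ = List (Letter d Γ)

-- Σ_{p,Γ}^* as a subset of Σ_{d,Γ}^*.
PriorityAtMost : ∀ {d} {Γ : Set a} → Fin (suc d) → Word d Γ → Set a
PriorityAtMost p = All (λ letter → proj₁ letter Fin.≤ p)

-- A derivation of x ⊑ y is a factorisation of y along x, one block
-- u (p , w) of y for each letter (p , v) of x.  Nothing may follow the
-- last block, so the last letter of x is matched to the last letter of y.
data PriorityEmbedding (d : ℕ) {Γ : Set a} (_≤Γ_ : Rel Γ ℓ) :
                       Rel (Word d Γ) (a ⊔ ℓ) where
  empty : PriorityEmbedding d _≤Γ_ [] []
  block : ∀ {p v w u x y} →
          PriorityAtMost p u →
          v ≤Γ w →
          PriorityEmbedding d _≤Γ_ x y →
          PriorityEmbedding d _≤Γ_ ((p , v) ∷ x) (u ++ (p , w) ∷ y)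

{-# OPTIONS --safe #-}
module Submission where

-- Minimal bad sequences (Nash-Williams) give Higman's lemma for the plain
-- subword order.  The theorem follows by induction on a strict bound n of the
-- priorities: a word over priorities ≤ n is u₀ B₁ … Bₖ, where u₀ has priorities
-- < n and every block Bᵢ is a letter of priority n followed by a word of
-- priorities < n.  A letter of priority n may skip everything before it, so a
-- subword embedding of B₁ … Bₖ₋₁, together with embeddings of u₀ and of the
-- last block Bₖ, yields a priority embedding.

open import Axiom.ExcludedMiddle using (ExcludedMiddle)
open import Data.Bool.Base using (Bool; false; true)
open import Data.Fin.Base using (toℕ)
open import Data.Fin.Properties using (toℕ<n; toℕ-injective)
open import Data.List.Base using (List; []; _∷_; _++_; length)
open import Data.List.Properties using (++-assoc; ++-identityʳ)
open import Data.List.Relation.Binary.Sublist.Heterogeneous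
  using (Sublist; []; _∷ʳ_; _∷_; minimum)
open import Data.List.Relation.Unary.All as All using (All; []; _∷_)
open import Data.List.Relation.Unary.All.Properties using (++⁺)
open import Data.Maybe.Base using (Maybe; just; nothing; is-just; fromMaybe)
open import Data.Maybe.Relation.Binary.Pointwise as Maybe using (just; nothing)
open import Data.Nat.Base using (ℕ; zero; suc; _∸_; _≤_; _<_; z≤n; s≤s; s≤s⁻¹)
open import Data.Nat.Induction using (<-wellFounded)
open import Data.Nat.Properties
  using ( _<?_; ≤-refl; ≤-reflexive; ≤-trans; <-trans; <-≤-trans; <-irrefl
        ; <⇒≤; <⇒≱; ≮⇒≥; n<1+n; n∸n≡0; ∸-monoˡ-<; m<n⇒m<1+n; m≤n⇒m<n∨m≡n )
open import Data.Product.Base using (∃; ∃₂; _×_; _,_; proj₁; proj₂; swap)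
open import Data.Product.Relation.Binary.Pointwise.NonDependent using (Pointwise)
open import Data.Sum.Base using (inj₁; inj₂)
open import Function.Base using (_∘_; _on_)
open import Induction.WellFounded using (Acc; acc)
open import Level using (Level; Lift; lift; lower; _⊔_; 0ℓ)
open import Relation.Binary.Core using (Rel)
open import Relation.Binary.Definitions using (Reflexive; Transitive)
open import Relation.Binary.PropositionalEquality
  using (_≡_; refl; sym; trans; cong; subst; subst₂; isEquivalence)
open import Relation.Binary.Structures using (IsPreorder)
open import Relation.Nullary using (¬_; Dec; yes; no; contradiction)
open import Relation.Nullary.Decidable using (decidable-stable; map′)
open import Relation.Unary using (Pred)
open import Defs

private
  variable
    a b p r s : Level

lowerEM : ∀ b → ExcludedMiddle (a ⊔ b) → ExcludedMiddle a
lowerEM b em = map′ lower lift (em {Lift b _})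

-- Good and bad sequences

GoodSequence : {A : Set a} → Rel A r → (ℕ → A) → Set r
GoodSequence R x = ∃₂ λ i j → i < j × R (x i) (x j)

Good : {A : Set a} → Rel A r → Set (a ⊔ r)
Good R = ∀ x → GoodSequence R x

Bad : {A : Set a} → Rel A r → (ℕ → A) → Set r
Bad R x = ∀ {i j} → i < j → ¬ R (x i) (x j)

-- Dependent choice, done by recursion because `next` returns its witnesses; transitivity carries
-- `T` from consecutive terms to all pairs. It is applied both to indices that can be continued and
-- to terminal ones.
chain : (P : Pred ℕ p) (T : Rel ℕ r) → Transitive T →
        (∀ i → P i → ∃ λ j → P j × T i j) → ∃ P →
        ∃ λ (φ : ℕ → ℕ) → (∀ i → P (φ i)) × (∀ {i j} → i < j → T (φ i) (φ j))
chain P T T-trans next start = φ , proj₂ ∘ state , λ i<j → ordered _ i<j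
  where
  state : ℕ → ∃ P
  state zero    = start
  state (suc k) = let (i , Pi) = state k ; (j , Pj , _) = next i Pi in j , Pj

  φ : ℕ → ℕ
  φ = proj₁ ∘ state

  step : ∀ k → T (φ k) (φ (suc k))
  step k = let (i , Pi) = state k in proj₂ (proj₂ (next i Pi))

  ordered : ∀ {i} j → i < j → T (φ i) (φ j)
  ordered (suc j) i<1+j with m≤n⇒m<n∨m≡n (s≤s⁻¹ i<1+j)
  ... | inj₁ i<j  = T-trans (ordered j i<j) (step j)
  ... | inj₂ refl = step j

-- If terminal indices occurred arbitrarily late, they would form a bad
-- subsequence; so from some point on every index can be continued.
monotoneSubsequence :
  {A : Set a} (R : Rel A r) → ExcludedMiddle r → Transitive R → Good R →
  (x : ℕ → A) →
  ∃ λ (φ : ℕ → ℕ) → ∀ {i j} → i < j → φ i < φ j × R (x (φ i)) (x (φ j))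
monotoneSubsequence R em R-trans R-good x = search em
  where
  _⟶_ : Rel ℕ _
  i ⟶ j = i < j × R (x i) (x j)

  Terminal : ℕ → Set _
  Terminal i = ¬ ∃ (i ⟶_)

  search : Dec (∃ λ N → ¬ ∃ λ i → N ≤ i × Terminal i) →
           ∃ λ (φ : ℕ → ℕ) → ∀ {i j} → i < j → φ i ⟶ φ j
  search (yes (N , none)) =
    let φ , _ , φ-mono = chain (N ≤_) _⟶_
          (λ (i<j , xi≤xj) (j<k , xj≤xk) → <-trans i<j j<k , R-trans xi≤xj xj≤xk)
          (λ i N≤i →
            let j , i⟶j = decidable-stable em (λ term → none (i , N≤i , term))
            in j , ≤-trans N≤i (<⇒≤ (proj₁ i⟶j)) , i⟶j)
          (N , ≤-refl)
    in φ , φ-mono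
  search (no recurrent) =
    let terminal = λ N → decidable-stable em (λ none → recurrent (N , none))
        φ , φ-term , φ-mono = chain Terminal _<_ <-trans
          (λ i _ → let j , i<j , term = terminal (suc i) in j , term , i<j)
          (let i , _ , term = terminal 0 in i , term)
        i , j , i<j , xi≤xj = R-good (x ∘ φ)
    in contradiction (φ j , φ-mono i<j , xi≤xj) (φ-term i)

-- First components increase along a subsequence, so a good pair of second components of that
-- subsequence is good in both.
good-× : {A : Set a} {B : Set b} (R : Rel A r) (S : Rel B s) →
         ExcludedMiddle r → Transitive R → Good R → Good S →
         Good (Pointwise R S)
good-× R S em R-trans R-good S-good x =
  let φ , φ-mono = monotoneSubsequence R em R-trans R-good (proj₁ ∘ x)
      i , j , i<j , yi≤yj = S-good (proj₂ ∘ x ∘ φ)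
      φi<φj , xi≤xj = φ-mono i<j
  in φ i , φ j , φi<φj , xi≤xj , yi≤yj

good-Bool : Good (_≡_ {A = Bool})
good-Bool x with x 0 in e₀ | x 1 in e₁ | x 2 in e₂
... | false | false | _     = 0 , 1 , s≤s z≤n , trans e₀ (sym e₁)
... | true  | true  | _     = 0 , 1 , s≤s z≤n , trans e₀ (sym e₁)
... | false | true  | false = 0 , 2 , s≤s z≤n , trans e₀ (sym e₂)
... | true  | false | true  = 0 , 2 , s≤s z≤n , trans e₀ (sym e₂)
... | false | true  | true  = 1 , 2 , s≤s (s≤s z≤n) , trans e₁ (sym e₂)
... | true  | false | false = 1 , 2 , s≤s (s≤s z≤n) , trans e₁ (sym e₂)

-- An optional value is coded as its constructor tag paired with its content, a default standing in
-- for `nothing`. The default is a value found among the first two terms; if both are `nothing`,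
-- they already form a good pair.
good-Maybe : {A : Set a} (R : Rel A r) → ExcludedMiddle 0ℓ →
             Good R → Good (Maybe.Pointwise R)
good-Maybe {A = A} R em R-good x = split (x 0) (x 1) refl refl
  where
  pointwise : ∀ {d} m n → is-just m ≡ is-just n →
              R (fromMaybe d m) (fromMaybe d n) → Maybe.Pointwise R m n
  pointwise (just _) (just _) _ mRn = just mRn
  pointwise nothing  nothing  _ _   = nothing

  withDefault : A → GoodSequence (Maybe.Pointwise R) x
  withDefault d =
    let i , j , i<j , e , xi≤xj =
          good-× _≡_ R em trans good-Bool R-good
            (λ k → is-just (x k) , fromMaybe d (x k))
    in i , j , i<j , pointwise (x i) (x j) e xi≤xj

  split : ∀ m n → x 0 ≡ m → x 1 ≡ n → GoodSequence (Maybe.Pointwise R) x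
  split (just d) _        _  _  = withDefault d
  split nothing  (just d) _  _  = withDefault d
  split nothing  nothing  e₀ e₁ =
    0 , 1 , s≤s z≤n , subst₂ (Maybe.Pointwise R) (sym e₀) (sym e₁) nothing

-- Minimal bad sequences

minimise : {A : Set a} (P : Pred A p) → ExcludedMiddle (a ⊔ p) →
           (μ : A → ℕ) → ∀ x → P x → ∃ λ y → P y × ∀ z → P z → μ y ≤ μ z
minimise P em μ x Px = descend x Px (<-wellFounded (μ x))
  where
  descend : ∀ x → P x → Acc _<_ (μ x) →
            ∃ λ y → P y × ∀ z → P z → μ y ≤ μ z
  descend x Px (acc rec) with em {∃ λ y → P y × μ y < μ x}
  ... | yes (y , Py , μy<μx) = descend y Py (rec μy<μx)
  ... | no  none = x , Px , λ z Pz → ≮⇒≥ λ μz<μx → none (z , Pz , μz<μx)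

Agree : {A : Set a} → ℕ → Rel (ℕ → A) a
Agree n s t = ∀ {k} → k < n → s k ≡ t k

BadFrom : {A : Set a} → Rel A r → ℕ → (ℕ → A) → Pred (ℕ → A) (a ⊔ r)
BadFrom R n s t = Bad R t × Agree n s t

MinimalAt : {A : Set a} → Rel A r → (A → ℕ) → (ℕ → A) → ℕ → Set (a ⊔ r)
MinimalAt R μ m n = ∀ t → BadFrom R n m t → μ (m n) ≤ μ (t n)

-- Stage `suc n` keeps the first `n` entries of stage `n` and makes entry `n` as small as a bad
-- sequence permits. Later stages leave that entry alone, so the diagonal `m` inherits badness and
-- minimality from the stages.
minimalBad : {A : Set a} (R : Rel A r) → ExcludedMiddle (a ⊔ r) →
             (μ : A → ℕ) → ∃ (Bad R) → ∃ λ m → Bad R m × ∀ n → MinimalAt R μ m n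
minimalBad {A = A} R em μ s₀ = m , m-bad , m-minimal
  where
  improve : ∀ n ((s , _) : ∃ (Bad R)) →
            ∃ λ s′ → BadFrom R n s s′ × ∀ t → BadFrom R n s t → μ (s′ n) ≤ μ (t n)
  improve n (s , s-bad) =
    minimise (BadFrom R n s) em (λ t → μ (t n)) s (s-bad , λ _ → refl)

  stage : ℕ → ∃ (Bad R)
  stage zero    = s₀
  stage (suc n) = let s , (s-bad , _) , _ = improve n (stage n) in s , s-bad

  m : ℕ → A
  m n = proj₁ (stage (suc n)) n

  m-agree : ∀ n → Agree n m (proj₁ (stage n))
  m-agree (suc n) k<1+n with m≤n⇒m<n∨m≡n (s≤s⁻¹ k<1+n)
  ... | inj₁ k<n  = let _ , (_ , agree) , _ = improve n (stage n)
                    in trans (m-agree n k<n) (agree k<n)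
  ... | inj₂ refl = refl

  m-bad : Bad R m
  m-bad {i} {j} i<j mi≤mj =
    -- Both terms occur in the single bad sequence `stage (suc j)`, where entry `i` is already
    -- final.
    proj₂ (stage (suc j)) i<j
      (subst (λ z → R z (m j)) (m-agree (suc j) (m<n⇒m<1+n i<j)) mi≤mj)

  m-minimal : ∀ n → MinimalAt R μ m n
  m-minimal n t (t-bad , agree) =
    proj₂ (proj₂ (improve n (stage n))) t
      (t-bad , λ k<n → trans (sym (m-agree n k<n)) (agree k<n))

-- A bad sequence t could be spliced into m at position φ 0, against the
-- minimality of m there.
¬bad-below-minimal :
  {A : Set a} (R : Rel A r) (μ : A → ℕ) {m t : ℕ → A} {φ : ℕ → ℕ} →
  Bad R m → MinimalAt R μ m (φ 0) →
  (∀ n → φ 0 ≤ φ n) →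
  (∀ n → μ (t n) < μ (m (φ n))) →
  (∀ n {x} → R x (t n) → R x (m (φ n))) →
  ¬ Bad R t
¬bad-below-minimal {A = A} R μ {m} {t} {φ} m-bad m-min φ0≤ t<m below t-bad =
  <⇒≱ (t<m 0) (subst (λ z → μ (m N) ≤ μ z) spliced-N
    (m-min spliced ((λ {i j} → spliced-bad i j) , agree)))
  where
  N : ℕ
  N = φ 0

  spliced : ℕ → A
  spliced k with k <? N
  ... | yes _ = m k
  ... | no  _ = t (k ∸ N)

  agree : Agree N m spliced
  agree {k} k<N with k <? N
  ... | yes _   = refl
  ... | no  k≮N = contradiction k<N k≮N

  spliced-N : spliced N ≡ t 0
  spliced-N with N <? N
  ... | yes N<N = contradiction N<N (<-irrefl refl)
  ... | no  _   = cong t (n∸n≡0 N)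

  spliced-bad : ∀ i j → i < j → ¬ R (spliced i) (spliced j)
  spliced-bad i j i<j with i <? N | j <? N
  ... | yes _   | yes _   = m-bad i<j
  -- A relation from `m` into `t` lifts by `below` to one inside `m`, whose target index is at least
  -- `N` and hence beyond `i`.
  ... | yes i<N | no  _   = m-bad (<-≤-trans i<N (φ0≤ (j ∸ N))) ∘ below (j ∸ N)
  ... | no  i≮N | yes j<N = contradiction (<-trans i<j j<N) i≮N
  ... | no  i≮N | no  _   = t-bad (∸-monoˡ-< i<j (≮⇒≥ i≮N))

-- The empty word embeds in everything, so a minimal bad sequence has only nonempty words. Along a
-- subsequence with increasing heads the tails are shorter and cannot be bad; a good pair of tails,
-- with the heads put back, is a good pair of the bad sequence.
higman : {A : Set a} (R : Rel A r) → ExcludedMiddle (a ⊔ r) →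
         Transitive R → Good R → Good (Sublist R)
higman {a = a} {A = A} R em R-trans R-good s =
  decidable-stable em λ not-good →
    refute (minimalBad (Sublist R) em length
      (s , λ i<j si≤sj → not-good (_ , _ , i<j , si≤sj)))
  where
  refute : ¬ ∃ λ m → Bad (Sublist R) m × ∀ n → MinimalAt (Sublist R) length m n
  refute (m , m-bad , m-min) = tails-bad tails-good
    where
    nonempty : ∀ n → ∃₂ λ x xs → m n ≡ x ∷ xs
    nonempty n with m n in mn≡
    ... | x ∷ xs = x , xs , refl
    ... | []     = contradiction
      (subst (λ z → Sublist R z (m (suc n))) (sym mn≡) (minimum _))
      (m-bad (n<1+n n))

    head : ℕ → A
    head n = proj₁ (nonempty n)

    tail : ℕ → List A
    tail n = proj₁ (proj₂ (nonempty n))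

    m≡ : ∀ n → m n ≡ head n ∷ tail n
    m≡ n = proj₂ (proj₂ (nonempty n))

    subsequence = monotoneSubsequence R (lowerEM a em) R-trans R-good head

    φ : ℕ → ℕ
    φ = proj₁ subsequence

    φ-mono : ∀ {i j} → i < j → φ i < φ j × R (head (φ i)) (head (φ j))
    φ-mono = proj₂ subsequence

    φ0≤ : ∀ n → φ 0 ≤ φ n
    φ0≤ zero    = ≤-refl
    φ0≤ (suc n) = <⇒≤ (proj₁ (φ-mono (s≤s z≤n)))

    tails-bad : ¬ GoodSequence (Sublist R) (tail ∘ φ)
    tails-bad (i , j , i<j , ti≤tj) =
      let φi<φj , hi≤hj = φ-mono i<j in
      m-bad φi<φj
        (subst₂ (Sublist R) (sym (m≡ (φ i))) (sym (m≡ (φ j))) (hi≤hj ∷ ti≤tj))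

    tails-good : GoodSequence (Sublist R) (tail ∘ φ)
    tails-good = decidable-stable em λ not-good →
      ¬bad-below-minimal (Sublist R) length {φ = φ} m-bad (m-min (φ 0)) φ0≤
        (λ n → ≤-reflexive (sym (cong length (m≡ (φ n)))))
        (λ n x≤t → subst (Sublist R _) (sym (m≡ (φ n))) (_ ∷ʳ x≤t))
        (λ i<j ti≤tj → not-good (_ , _ , i<j , ti≤tj))

-- The priority embedding

module _ {a ℓ} (d : ℕ) {Γ : Set a} (_≤Γ_ : Rel Γ ℓ) where

  private
    _⊑_ : Rel (Word d Γ) (a ⊔ ℓ)
    _⊑_ = PriorityEmbedding d _≤Γ_

  ⊑-refl : Reflexive _≤Γ_ → Reflexive _⊑_
  ⊑-refl ≤Γ-refl {[]}    = empty
  ⊑-refl ≤Γ-refl {_ ∷ _} = block [] ≤Γ-refl (⊑-refl ≤Γ-refl)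

  -- The key to transitivity. The letters of `u` have priority at most `p`, and so do the gaps
  -- before their images; all of this merges into one admissible gap before the image of `(p , w)`.
  ⊑-++ˡ-inv : ∀ {p w y} u {z} → PriorityAtMost p u → (u ++ (p , w) ∷ y) ⊑ z →
              ∃ λ u′ → ∃₂ λ w′ z′ → z ≡ u′ ++ (p , w′) ∷ z′ ×
                PriorityAtMost p u′ × w ≤Γ w′ × y ⊑ z′
  ⊑-++ˡ-inv []      []          (block u′≤p w≤w′ y⊑z′) =
    _ , _ , _ , refl , u′≤p , w≤w′ , y⊑z′
  ⊑-++ˡ-inv (_ ∷ u) (q≤p ∷ u≤p) (block {w = c} {u = v} v≤q _ rest)
    with ⊑-++ˡ-inv u u≤p rest
  ... | u′ , w′ , z′ , refl , u′≤p , w≤w′ , y⊑z′ =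
    v ++ (_ , c) ∷ u′ , w′ , z′ , sym (++-assoc v _ _) ,
    ++⁺ (All.map (λ o≤q → ≤-trans o≤q q≤p) v≤q) (q≤p ∷ u′≤p) , w≤w′ , y⊑z′

  ⊑-trans : Transitive _≤Γ_ → Transitive _⊑_
  ⊑-trans ≤Γ-trans empty empty = empty
  ⊑-trans ≤Γ-trans (block {u = u} u≤p v≤w x⊑y) y⊑z with ⊑-++ˡ-inv u u≤p y⊑z
  ... | _ , _ , _ , refl , u′≤p , w≤w′ , y⊑z′ =
    block u′≤p (≤Γ-trans v≤w w≤w′) (⊑-trans ≤Γ-trans x⊑y y⊑z′)

  ⊑-++ : ∀ {x x′ y y′} → x ⊑ x′ → y ⊑ y′ → (x ++ y) ⊑ (x′ ++ y′)
  ⊑-++ empty y⊑y′ = y⊑y′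
  ⊑-++ (block {u = u} u≤p v≤w x⊑x′) y⊑y′ =
    subst (_ ⊑_) (sym (++-assoc u _ _)) (block u≤p v≤w (⊑-++ x⊑x′ y⊑y′))

  -- The gap before the image of the first letter absorbs `u`.
  ⊑-skip : ∀ {p v x y} u → PriorityAtMost p u →
           ((p , v) ∷ x) ⊑ y → ((p , v) ∷ x) ⊑ (u ++ y)
  ⊑-skip u u≤p (block {u = u′} u′≤p v≤w x⊑y) =
    subst (_ ⊑_) (++-assoc u u′ _) (block (++⁺ u≤p u′≤p) v≤w x⊑y)

  -- Factorisation of words into blocks

  Low : ℕ → Set a
  Low n = ∃ λ (w : Word d Γ) → All (λ letter → toℕ (proj₁ letter) < n) w

  Top : ℕ → Set a
  Top n = ∃ λ (letter : Letter d Γ) → toℕ (proj₁ letter) ≡ n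

  module _ {n : ℕ} where

    Block : Set a
    Block = Top n × Low n

    -- The blocks B₁ … Bₖ with the last one kept apart; nothing if k = 0.
    Blocks : Set a
    Blocks = Maybe (List Block × Block)

    _⊑ᴸ_ : Rel (Low n) (a ⊔ ℓ)
    _⊑ᴸ_ = _⊑_ on proj₁

    _≤ᵀ_ : Rel (Top n) ℓ
    _≤ᵀ_ = _≤Γ_ on (proj₂ ∘ proj₁)

    _≤ᴮ_ : Rel Block (a ⊔ ℓ)
    _≤ᴮ_ = Pointwise _≤ᵀ_ _⊑ᴸ_

    -- Last blocks are compared with each other: a subword embedding of the whole lists might leave
    -- blocks after the last matched one, where a priority embedding permits no gap.
    _≤⁺_ : Rel (List Block × Block) (a ⊔ ℓ)
    _≤⁺_ = Pointwise (Sublist _≤ᴮ_) _≤ᴮ_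

    flattenBlock : Block → Word d Γ
    flattenBlock ((letter , _) , (u , _)) = letter ∷ u

    flatten⁺ : List Block → Block → Word d Γ
    flatten⁺ []       b = flattenBlock b
    flatten⁺ (c ∷ cs) b = flattenBlock c ++ flatten⁺ cs b

    flatten : Blocks → Word d Γ
    flatten nothing         = []
    flatten (just (bs , b)) = flatten⁺ bs b

    cons : Block → Blocks → List Block × Block
    cons b nothing         = [] , b
    cons b (just (cs , c)) = b ∷ cs , c

    flatten-cons : ∀ b m → flatten (just (cons b m)) ≡ flattenBlock b ++ flatten m
    flatten-cons b nothing  = sym (++-identityʳ _)
    flatten-cons b (just _) = refl

    -- The word is read from the right. A letter below `n` joins the leading low part; a letter of
    -- priority `n` closes that part into a new first block and leaves an empty low part.
    factorise : ((w , _) : Low (suc n)) →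
                ∃₂ λ (u : Low n) m → w ≡ proj₁ u ++ flatten m
    factorise ([] , [])             = ([] , []) , nothing , refl
    factorise (l ∷ w , l<1+n ∷ w≤n)
      with factorise (w , w≤n) | m≤n⇒m<n∨m≡n (s≤s⁻¹ l<1+n)
    ... | (u , u<n) , m , refl | inj₁ l<n = (l ∷ u , l<n ∷ u<n) , m , refl
    ... | u         , m , refl | inj₂ l≡n =
      ([] , []) , just (cons b₀ m) , sym (flatten-cons b₀ m)
      where b₀ = (l , l≡n) , u

    flattenBlock-mono : ∀ b c → b ≤ᴮ c → flattenBlock b ⊑ flattenBlock c
    flattenBlock-mono (((p , _) , p≡n) , _) (((q , _) , q≡n) , _) (v≤w , x⊑y)
      with refl ← toℕ-injective {i = p} {q} (trans p≡n (sym q≡n)) = block [] v≤w x⊑y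

    flattenBlock-atMost : ∀ (((p , _) , _) : Top n) c →
                          PriorityAtMost p (flattenBlock c)
    flattenBlock-atMost (_ , p≡n) ((_ , q≡n) , (_ , u<n)) =
      ≤-reflexive (trans q≡n (sym p≡n)) ∷
      All.map (λ o<n → <⇒≤ (subst (_ <_) (sym p≡n) o<n)) u<n

    -- Even for empty `bs` the left word starts with a letter of priority `n`, because of `b`; the
    -- gap before that letter admits any block.
    flatten⁺-skip : ∀ bs b c {y} →
                    flatten⁺ bs b ⊑ y → flatten⁺ bs b ⊑ (flattenBlock c ++ y)
    flatten⁺-skip []            (top , _) c = ⊑-skip _ (flattenBlock-atMost top c)
    flatten⁺-skip ((top , _) ∷ _) _       c = ⊑-skip _ (flattenBlock-atMost top c)

    flatten⁺-mono : ∀ {bs cs} b c → Sublist _≤ᴮ_ bs cs → b ≤ᴮ c →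
                    flatten⁺ bs b ⊑ flatten⁺ cs c
    flatten⁺-mono b c [] b≤c = flattenBlock-mono b c b≤c
    flatten⁺-mono {bs} b c (c₀ ∷ʳ bs≤cs) b≤c =
      flatten⁺-skip bs b c₀ (flatten⁺-mono b c bs≤cs b≤c)
    flatten⁺-mono b c (_∷_ {x = b₀} {y = c₀} b₀≤c₀ bs≤cs) b≤c =
      ⊑-++ (flattenBlock-mono b₀ c₀ b₀≤c₀) (flatten⁺-mono b c bs≤cs b≤c)

    flatten-mono : ∀ {m m′} → Maybe.Pointwise _≤⁺_ m m′ → flatten m ⊑ flatten m′
    flatten-mono nothing = empty
    flatten-mono (just {_ , b} {_ , c} (bs≤cs , b≤c)) = flatten⁺-mono b c bs≤cs b≤c

  -- Induction on the priority bound

  good-Low : ExcludedMiddle (a ⊔ ℓ) → Transitive _≤Γ_ → Good _≤Γ_ →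
             ∀ n → Good (_⊑ᴸ_ {n})
  -- No priority is strictly below zero, so both words are empty.
  good-Low em ≤Γ-trans ≤Γ-good zero x with x 0 in e₀ | x 1 in e₁
  ... | [] , [] | [] , [] =
    0 , 1 , s≤s z≤n , subst₂ _⊑ᴸ_ (sym e₀) (sym e₁) empty
  good-Low em ≤Γ-trans ≤Γ-good (suc n) x =
    let i , j , i<j , u≤u′ , m≤m′ =
          good-× _⊑ᴸ_ (Maybe.Pointwise _≤⁺_) em (⊑-trans ≤Γ-trans) low-good
            (good-Maybe _≤⁺_ (lowerEM (a ⊔ ℓ) em) ≤⁺-good) (λ k → u k , m k)
    in i , j , i<j ,
       subst₂ _⊑_ (sym (x≡ i)) (sym (x≡ j)) (⊑-++ u≤u′ (flatten-mono m≤m′))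
    where
    low-good : Good (_⊑ᴸ_ {n})
    low-good = good-Low em ≤Γ-trans ≤Γ-good n

    ≤ᴮ-trans : Transitive (_≤ᴮ_ {n})
    ≤ᴮ-trans (v≤w , x⊑y) (w≤z , y⊑z) = ≤Γ-trans v≤w w≤z , ⊑-trans ≤Γ-trans x⊑y y⊑z

    ≤ᴮ-good : Good (_≤ᴮ_ {n})
    ≤ᴮ-good = good-× _≤ᵀ_ _⊑ᴸ_ (lowerEM a em) ≤Γ-trans
      (λ y → ≤Γ-good (proj₂ ∘ proj₁ ∘ y)) low-good

    ≤⁺-good : Good (_≤⁺_ {n})
    ≤⁺-good y =
      -- `good-×` extracts its monotone subsequence in the first factor, so `swap` puts the last
      -- blocks there, where `≤ᴮ-trans` is at hand.
      let i , j , i<j , b≤c , bs≤cs =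
            good-× _≤ᴮ_ (Sublist _≤ᴮ_) em
              (λ {b₁ b₂ b₃} → ≤ᴮ-trans {b₁} {b₂} {b₃}) ≤ᴮ-good
              (higman _≤ᴮ_ em (λ {b₁ b₂ b₃} → ≤ᴮ-trans {b₁} {b₂} {b₃}) ≤ᴮ-good)
              (swap ∘ y)
      in i , j , i<j , bs≤cs , b≤c

    u : ℕ → Low n
    u k = proj₁ (factorise (x k))

    m : ℕ → Blocks
    m k = proj₁ (proj₂ (factorise (x k)))

    x≡ : ∀ k → proj₁ (x k) ≡ proj₁ (u k) ++ flatten (m k)
    x≡ k = proj₂ (proj₂ (factorise (x k)))

theorem3p6 : {a ℓ : Level} → ExcludedMiddle (a ⊔ ℓ) →
    (d : ℕ) {Γ : Set a} (_≤Γ_ : Rel Γ ℓ) →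
    IsWellQuasiOrder _≤Γ_ →
    IsWellQuasiOrder (PriorityEmbedding d _≤Γ_)
theorem3p6 em d _≤Γ_ ≤Γ-wqo = record
  { isQuasiOrder = record
    { isEquivalence = isEquivalence
    ; reflexive     = λ { refl → ⊑-refl d _≤Γ_ ≤Γ.refl }
    ; trans         = ⊑-trans d _≤Γ_ ≤Γ.trans
    }
  ; good = λ x →
      -- Priorities are at most `d`, so the strict bound `suc d` covers all words.
      good-Low d _≤Γ_ em ≤Γ.trans (IsWellQuasiOrder.good ≤Γ-wqo) (suc d)
        (λ i → x i , All.universal (λ letter → toℕ<n (proj₁ letter)) (x i))
  }
  where
  module ≤Γ = IsPreorder (IsWellQuasiOrder.isQuasiOrder ≤Γ-wqo)
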